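{- Let $V$ be a finite nonempty set, let $d \ge 1$ be an integer, and let $R = (\le_1, \ldots, \le_d)$ be a $d$-representation on $V$. Then the supremum section $\Sigma(R)$ is collapsible.
   Context: A $d$-representation on $V$ is a family of $d$ linear orders $\le_1,\ldots,\le_d$ on $V$. For a linear order $\le$ on $V$, $x\in V$ and $F\subseteq V$, $x$ dominates $F$ in $\le$ if $f\le x$ for every $f\in F$; $x$ dominates $F$ in $R$ if $x$ dominates $F$ in some $\le_i$. The supremum section $\Sigma(R)$ is the set of all subsets $F\subseteq V$ such that every $v\in V$ dominates $F$ in $R$ (in particular $\emptyset\in\Sigma(R)$); it is an abstract simplicial complex (a family of subsets of $V$ closed under taking subsets), whose elements are called faces and whose inclusion-maximal faces are called facets. A face $F$ of a simplicial complex $\Delta$ is free if it is nonempty, not maximal, and contained in exactly one facet of $\Delta$. $\Delta$ collapses to $\Gamma$ if there are simplicial complexes $\Delta_1=\Delta,\Delta_2,\ldots,\Delta_k=\Gamma$ and, for each $i\le k-1$, a free face $F_i$ of $\Delta_i$ with $\Delta_{i+1}=\Delta_i\setminus\{F\in\Delta_i : F_i\subseteq F\}$. $\Delta$ is collapsible if it collapses to a point, i.e. to a complex of the form $\{\emptyset,\{v\}\}$. -}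

module Defs where

open import Data.Nat using (ℕ)
open import Data.Fin using (Fin)
open import Data.Fin.Subset using (Subset; _∈_; _⊆_; Nonempty; ⊥; ⁅_⁆)
open import Data.Fin.Subset.Properties using (⊆-antisym; ⊥⊆; nonempty?; Empty-unique; x∈⁅y⁆⇒x≡y)
open import Data.Product using (∃; ∃!; _×_; _,_)
open import Data.Sum using (_⊎_; inj₁; inj₂)
open import Level using (0ℓ)
open import Relation.Binary.Core using (Rel)
open import Relation.Binary.Structures using (IsTotalOrder)
open import Relation.Binary.PropositionalEquality using (_≡_; refl)
open import Relation.Nullary using (¬_; yes; no)
open import Relation.Unary using (Pred; _≐_)

-- The ground set V is Fin n.

record Representation (d n : ℕ) : Set₁ where
  field
    order        : Fin d → Rel (Fin n) 0ℓ
    isTotalOrder : ∀ i → IsTotalOrder _≡_ (order i)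

DominatesIn : {n : ℕ} → Rel (Fin n) 0ℓ → Fin n → Subset n → Set
DominatesIn _≤_ x F = ∀ f → f ∈ F → f ≤ x

Dominates : {d n : ℕ} → Representation d n → Fin n → Subset n → Set
Dominates R x F = ∃ λ i → DominatesIn (Representation.order R i) x F

record SimplicialComplex (n : ℕ) : Set₁ where
  field
    Face   : Pred (Subset n) 0ℓ
    closed : ∀ {F G} → F ⊆ G → Face G → Face F

open SimplicialComplex public

supremumSection : {d n : ℕ} → Representation d n → SimplicialComplex n
supremumSection R = record
  { Face   = λ F → ∀ v → Dominates R v F
  ; closed = λ F⊆G dom v → let (i , dom-i) = dom v in i , λ f f∈F → dom-i f (F⊆G f∈F)
  }

Facet : {n : ℕ} → SimplicialComplex n → Subset n → Set
Facet Δ F = Face Δ F × (∀ G → Face Δ G → F ⊆ G → G ≡ F)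

Free : {n : ℕ} → SimplicialComplex n → Subset n → Set
Free Δ F = Face Δ F × Nonempty F × ¬ Facet Δ F × ∃! _≡_ (λ G → Facet Δ G × F ⊆ G)

ElementaryCollapse : {n : ℕ} → SimplicialComplex n → SimplicialComplex n → Set
ElementaryCollapse Δ Γ =
  ∃ λ F → Free Δ F × Face Γ ≐ (λ G → Face Δ G × ¬ (F ⊆ G))

-- A term of CollapsesTo Δ Γ is a sequence Δ = Δ₁, …, Δₖ = Γ of elementary
-- collapses. Complexes are compared extensionally (by _≐_), since two
-- predicates with the same members need not be propositionally equal.
data CollapsesTo {n : ℕ} (Δ Γ : SimplicialComplex n) : Set₁ where
  done : Face Δ ≐ Face Γ → CollapsesTo Δ Γ
  step : (Δ′ : SimplicialComplex n) → ElementaryCollapse Δ Δ′ →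
         CollapsesTo Δ′ Γ → CollapsesTo Δ Γ

point : {n : ℕ} → Fin n → SimplicialComplex n
point {n} v = record { Face = PointFace ; closed = closed′ }
  where
  PointFace : Pred (Subset n) 0ℓ
  PointFace F = F ≡ ⊥ ⊎ F ≡ ⁅ v ⁆

  closed′ : ∀ {F G} → F ⊆ G → PointFace G → PointFace F
  closed′ F⊆⊥ (inj₁ refl) = inj₁ (⊆-antisym F⊆⊥ ⊥⊆)
  closed′ {F} F⊆v (inj₂ refl) with nonempty? F
  ... | no  empty     = inj₁ (Empty-unique empty)
  ... | yes (x , x∈F) = inj₂ (⊆-antisym F⊆v v⊆F)
    where
    v⊆F : ⁅ v ⁆ ⊆ F
    v⊆F y∈v with refl ← x∈⁅y⁆⇒x≡y v y∈v | refl ← x∈⁅y⁆⇒x≡y v (F⊆v x∈F) = x∈F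

Collapsible : {n : ℕ} → SimplicialComplex n → Set₁
Collapsible Δ = ∃ λ v → CollapsesTo Δ (point v)

{-# OPTIONS --safe #-}
module Submission where

-- For an already chosen set X, consider the complex of all F ⊆ W such that
-- every p ∈ W dominates F ∪ X.  Let y be the maximum of W in the first order.
-- If y does not dominate X there, then no element of W does, and the first
-- order can be dropped.  Otherwise y dominates everything in the first order,
-- so it imposes no condition: the deletion of y is the complex of (W - y , X),
-- and, since no p ≠ y can dominate y in the first order, the link of y is the
-- complex of (W - y , X ∪ ⁅ y ⁆) for the remaining orders.  Both collapse to a
-- point by induction, and collapsing the link yields a collapse onto the
-- deletion.

open import Defs
open import Data.Nat using (ℕ; zero; suc; _≤_; _<_; s≤s)
open import Data.Nat.Induction using (<-wellFounded)
open import Data.Fin using (Fin; zero; suc)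
open import Data.Fin.Properties using (_≟_; all?; any?)
open import Data.Fin.Subset using (Subset; inside; outside; _∈_; _∉_; _⊆_; Nonempty; ⊥; ⊤; ⁅_⁆; _∪_; _─_; _-_; ∣_∣)
open import Data.Fin.Subset.Properties
open import Data.List using (allFin; filter)
import Data.List.Extrema as Extrema
import Data.List.Relation.Unary.All as All
open import Data.List.Membership.Propositional.Properties using (∈-allFin; ∈-filter⁺; ∈-filter⁻)
open import Data.Product using (∃; _×_; _,_; proj₁; proj₂)
open import Data.Sum using (inj₁; inj₂; [_,_]′)
open import Data.Vec using (_∷_; there)
open import Function using (_∘_; id)
open import Induction.WellFounded using (Acc; acc)
open import Level using (0ℓ)
open import Relation.Binary.Bundles using (TotalOrder)
open import Relation.Binary.Consequences using (total∧dec⇒dec)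
open import Relation.Binary.Core using (Rel)
open import Relation.Binary.Definitions using (Decidable)
open import Relation.Binary.PropositionalEquality using (_≡_; refl; sym; subst)
open import Relation.Binary.Structures using (IsTotalOrder)
open import Relation.Nullary using (Dec; ¬_; yes; no; contradiction; _→-dec_)
open import Relation.Unary using (_≐_)
open import Relation.Unary.Properties using (≐-sym; ≐-trans)

private
  variable
    d n : ℕ
    x y : Fin n
    F G : Subset n

-- Removing and adding an element of a finite subset.

x∈p─q⇒x∉q : ∀ (p q : Subset n) → x ∈ p ─ q → x ∉ q
x∈p─q⇒x∉q (_ ∷ p) (inside  ∷ q) (there x∈p─q) (there x∈q) = x∈p─q⇒x∉q p q x∈p─q x∈q
x∈p─q⇒x∉q (_ ∷ p) (outside ∷ q) (there x∈p─q) (there x∈q) = x∈p─q⇒x∉q p q x∈p─q x∈q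

x∉p-x : ∀ (p : Subset n) x → x ∉ p - x
x∉p-x p x x∈p-x = x∈p─q⇒x∉q p ⁅ x ⁆ x∈p-x (x∈⁅x⁆ x)

p-y⊆p : ∀ (p : Subset n) y → p - y ⊆ p
p-y⊆p p y = p─q⊆p p ⁅ y ⁆

∪-least : ∀ {p q r : Subset n} → p ⊆ r → q ⊆ r → p ∪ q ⊆ r
∪-least {p = p} {q} p⊆r q⊆r = [ p⊆r , q⊆r ]′ ∘ x∈p∪q⁻ p q

∪-mono-⊆ : ∀ {p q r s : Subset n} → p ⊆ q → r ⊆ s → p ∪ r ⊆ q ∪ s
∪-mono-⊆ p⊆q r⊆s = ∪-least (p⊆p∪q _ ∘ p⊆q) (q⊆p∪q _ _ ∘ r⊆s)

⁅x⁆⊆p : ∀ {p : Subset n} → x ∈ p → ⁅ x ⁆ ⊆ p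
⁅x⁆⊆p {x = x} {p} x∈p z∈x = subst (_∈ p) (sym (x∈⁅y⁆⇒x≡y x z∈x)) x∈p

y∈p∪⁅y⁆ : ∀ (p : Subset n) y → y ∈ p ∪ ⁅ y ⁆
y∈p∪⁅y⁆ p y = q⊆p∪q p ⁅ y ⁆ (x∈⁅x⁆ y)

p⊆[p-y]∪⁅y⁆ : ∀ (p : Subset n) y → p ⊆ (p - y) ∪ ⁅ y ⁆
p⊆[p-y]∪⁅y⁆ p y {z} z∈p with z ≟ y
... | yes refl = y∈p∪⁅y⁆ (p - y) y
... | no  z≢y  = p⊆p∪q ⁅ y ⁆ (x∈p∧x≢y⇒x∈p-y z∈p z≢y)

p⊆q-y : ∀ {p q : Subset n} → p ⊆ q → y ∉ p → p ⊆ q - y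
p⊆q-y p⊆q y∉p x∈p = x∈p∧x≢y⇒x∈p-y (p⊆q x∈p) λ { refl → y∉p x∈p }

∪⁅y⁆-cancel-⊆ : ∀ {p q : Subset n} → y ∉ p → p ∪ ⁅ y ⁆ ⊆ q ∪ ⁅ y ⁆ → p ⊆ q
∪⁅y⁆-cancel-⊆ {y = y} {p} {q} y∉p sub {x} x∈p with x∈p∪q⁻ q ⁅ y ⁆ (sub (p⊆p∪q ⁅ y ⁆ x∈p))
... | inj₁ x∈q = x∈q
... | inj₂ x∈y = contradiction (subst (_∈ p) (x∈⁅y⁆⇒x≡y y x∈y) x∈p) y∉p

-- Free pairs and collapses.

record FreePair (Δ : SimplicialComplex n) (F G : Subset n) : Set where
  field
    F⊆G      : F ⊆ G
    G⊈F      : ¬ (G ⊆ F)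
    face     : Face Δ G
    greatest : ∀ H → Face Δ H → F ⊆ H → H ⊆ G

open FreePair

-- A greatest face above `F` is the only facet above `F`, and `G⊈F` keeps `F` from being maximal.
-- Nonemptiness stays separate because a pair with empty `F` in a link still lifts to a free face.
freePair⇒free : (Δ : SimplicialComplex n) → FreePair Δ F G → Nonempty F → Free Δ F
freePair⇒free {F = F} {G} Δ fp ne =
  closed Δ (F⊆G fp) (face fp) , ne , not-facet , G , (facet , F⊆G fp) , unique
  where
  not-facet : ¬ Facet Δ F
  not-facet (_ , maximal) = G⊈F fp (subst (_⊆ F) (sym (maximal G (face fp) (F⊆G fp))) id)

  facet : Facet Δ G
  facet = face fp , λ H H∈Δ G⊆H → ⊆-antisym (greatest fp H H∈Δ (G⊆H ∘ F⊆G fp)) G⊆H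

  unique : ∀ {H} → Facet Δ H × F ⊆ H → G ≡ H
  unique ((H∈Δ , maximal) , F⊆H) = maximal G (face fp) (greatest fp _ H∈Δ F⊆H)

-- A free face F determines a free pair (F , G) only when every face lies in a
-- facet, which cannot be shown for undecidable complexes; so collapses that have
-- to be lifted from a link carry the pair.
data PairCollapsible {n : ℕ} (Δ : SimplicialComplex n) : Set₁ where
  isPoint : ∀ v → Face Δ ≐ Face (point v) → PairCollapsible Δ
  remove  : ∀ F G → Nonempty F → FreePair Δ F G → (Δ′ : SimplicialComplex n) →
            Face Δ′ ≐ (λ H → Face Δ H × ¬ (F ⊆ H)) →
            PairCollapsible Δ′ → PairCollapsible Δ

pairCollapsible⇒collapsible : {Δ : SimplicialComplex n} → PairCollapsible Δ → Collapsible Δ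
pairCollapsible⇒collapsible (isPoint v eq) = v , done eq
pairCollapsible⇒collapsible {Δ = Δ} (remove F G ne fp Δ′ eq c) =
  let (v , c′) = pairCollapsible⇒collapsible c
  in v , step Δ′ (F , freePair⇒free Δ fp ne , eq) c′

pairCollapsible-resp-≐ : {Δ Γ : SimplicialComplex n} → Face Δ ≐ Face Γ →
                         PairCollapsible Δ → PairCollapsible Γ
pairCollapsible-resp-≐ Δ≐Γ (isPoint v eq) = isPoint v (≐-trans (≐-sym Δ≐Γ) eq)
pairCollapsible-resp-≐ (Δ⊆Γ , Γ⊆Δ) (remove F G ne fp Δ′ (to , from) c) =
  remove F G ne fp′ Δ′
    ( (λ H∈Δ′ → let (H∈Δ , F⊈H) = to H∈Δ′ in Δ⊆Γ H∈Δ , F⊈H)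
    , (λ (H∈Γ , F⊈H) → from (Γ⊆Δ H∈Γ , F⊈H)))
    c
  where
  fp′ : FreePair _ F G
  fp′ = record
    { F⊆G      = F⊆G fp
    ; G⊈F      = G⊈F fp
    ; face     = Δ⊆Γ (face fp)
    ; greatest = λ H H∈Γ → greatest fp H (Γ⊆Δ H∈Γ)
    }

-- Deletions and links of a vertex.

IsDeletion : SimplicialComplex n → Fin n → SimplicialComplex n → Set
IsDeletion Δ y D = Face D ≐ λ F → Face Δ F × y ∉ F

IsLink : SimplicialComplex n → Fin n → SimplicialComplex n → Set
IsLink Δ y L = Face L ≐ λ F → Face Δ (F ∪ ⁅ y ⁆) × y ∉ F

-- A face of `Δ` above `F ∪ ⁅ y ⁆` loses `y` to become a face of the link above `F`, hence lies in
-- `G`; putting `y` back gives the bound.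
link-freePair⁺ : {Δ L : SimplicialComplex n} → IsLink Δ y L → FreePair L F G →
                 FreePair Δ (F ∪ ⁅ y ⁆) (G ∪ ⁅ y ⁆)
link-freePair⁺ {y = y} {F} {G} {Δ = Δ} {L} (to , from) fp = record
  { F⊆G      = ∪-mono-⊆ (F⊆G fp) id
  ; G⊈F      = G⊈F fp ∘ ∪⁅y⁆-cancel-⊆ (proj₂ (to (face fp)))
  ; face     = proj₁ (to (face fp))
  ; greatest = λ H H∈Δ F∪y⊆H →
      let
        y∈H   = F∪y⊆H (y∈p∪⁅y⁆ F y)
        H-y∈L = from (closed Δ (∪-least (p-y⊆p H y) (⁅x⁆⊆p y∈H)) H∈Δ , x∉p-x H y)
        F⊆H-y = p⊆q-y (F∪y⊆H ∘ p⊆p∪q ⁅ y ⁆) y∉F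
      in ∪-mono-⊆ (greatest fp (H - y) H-y∈L F⊆H-y) id ∘ p⊆[p-y]∪⁅y⁆ H y
  }
  where
  y∉F : y ∉ F
  y∉F = proj₂ (to (closed L (F⊆G fp) (face fp)))

removeAbove : SimplicialComplex n → Subset n → SimplicialComplex n
removeAbove Δ F = record
  { Face   = λ G → Face Δ G × ¬ (F ⊆ G)
  ; closed = λ G⊆H (H∈Δ , F⊈H) → closed Δ G⊆H H∈Δ , λ F⊆G → F⊈H (G⊆H ∘ F⊆G)
  }

-- Recursion on the collapse of the link: each removal lifts by adding `y`, so only faces containing
-- `y` go and the deletion stays the same. Once the link is a point, removing `⁅ y ⁆` leaves just
-- `D`, which has its own collapse.
collapsible-link-deletion : {Δ D L : SimplicialComplex n} → IsDeletion Δ y D → IsLink Δ y L →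
                            PairCollapsible D → PairCollapsible L → PairCollapsible Δ
collapsible-link-deletion {y = y} {D = D} {L} (toD , fromD) isLink cD (isPoint v (toPt , fromPt)) =
  -- This lifts the pair (`⊥`, `⁅ v ⁆`) of the link, whose lower face becomes nonempty only through
  -- `y`.
  remove (⊥ ∪ ⁅ y ⁆) (⁅ v ⁆ ∪ ⁅ y ⁆) (y , y∈p∪⁅y⁆ ⊥ y) (link-freePair⁺ {L = L} isLink ⊥-v) D
    ( (λ H∈D → let (H∈Δ , y∉H) = toD H∈D in H∈Δ , λ sub → y∉H (sub (y∈p∪⁅y⁆ ⊥ y)))
    , (λ (H∈Δ , ⊥∪y⊈H) → fromD (H∈Δ , λ y∈H → ⊥∪y⊈H (∪-least ⊥⊆ (⁅x⁆⊆p y∈H)))))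
    cD
  where
  ⊥-v : FreePair L ⊥ ⁅ v ⁆
  ⊥-v = record
    { F⊆G      = ⊥⊆
    ; G⊈F      = λ v⊆⊥ → ∉⊥ (v⊆⊥ (x∈⁅x⁆ v))
    ; face     = fromPt (inj₂ refl)
    ; greatest = λ H H∈L _ → [ (λ { refl → ⊥⊆ }) , (λ { refl → id }) ]′ (toPt H∈L)
    }
collapsible-link-deletion {y = y} {Δ = Δ} {D} {L} (toD , fromD) isLink@(toL , fromL) cD
                          (remove F G _ fp L′ (toL′ , fromL′) cL′) =
  remove (F ∪ ⁅ y ⁆) (G ∪ ⁅ y ⁆) (y , y∈p∪⁅y⁆ F y) (link-freePair⁺ {L = L} isLink fp) Δ′ (id , id)
    (collapsible-link-deletion {D = D} isDeletion′ isLink′ cD cL′)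
  where
  Δ′ : SimplicialComplex _
  Δ′ = removeAbove Δ (F ∪ ⁅ y ⁆)

  y∉F : y ∉ F
  y∉F = proj₂ (toL (closed L (F⊆G fp) (face fp)))

  isDeletion′ : IsDeletion Δ′ y D
  isDeletion′ =
      (λ H∈D → let (H∈Δ , y∉H) = toD H∈D
               in (H∈Δ , λ sub → y∉H (sub (y∈p∪⁅y⁆ F y))) , y∉H)
    , (λ ((H∈Δ , _) , y∉H) → fromD (H∈Δ , y∉H))

  isLink′ : IsLink Δ′ y L′
  isLink′ =
      (λ H∈L′ → let (H∈L , F⊈H) = toL′ H∈L′
                    (H∪y∈Δ , y∉H) = toL H∈L
                in (H∪y∈Δ , F⊈H ∘ ∪⁅y⁆-cancel-⊆ y∉F) , y∉H)
    , (λ ((H∪y∈Δ , F∪y⊈H∪y) , y∉H) →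
         fromL′ (fromL (H∪y∈Δ , y∉H) , λ F⊆H → F∪y⊈H∪y (∪-mono-⊆ F⊆H id)))

-- Decidability and maxima in a total order.

module _ {_≼_ : Rel (Fin n) 0ℓ} (isTotalOrder : IsTotalOrder _≡_ _≼_) where
  private
    totalOrder : TotalOrder 0ℓ 0ℓ 0ℓ
    totalOrder = record { isTotalOrder = isTotalOrder }

  open IsTotalOrder isTotalOrder using (reflexive; antisym; total)

  -- A representation carries no decision procedure; totality, antisymmetry and decidable equality
  -- on `Fin n` supply one.
  totalOrder⇒dec : Decidable _≼_
  totalOrder⇒dec = total∧dec⇒dec reflexive antisym total _≟_

  dominatesIn? : ∀ x F → Dec (DominatesIn _≼_ x F)
  dominatesIn? x F = all? λ f → (f ∈? F) →-dec totalOrder⇒dec f x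

  maximum : (W : Subset n) → Nonempty W → ∃ λ y → y ∈ W × DominatesIn _≼_ y W
  maximum W (w , w∈W) =
      -- The default `w` is in `W`, so the maximum is in `W` too.
      max w ws
    , argmax-all id w∈W (All.tabulate (proj₂ ∘ ∈-filter⁻ (_∈? W) {xs = allFin n}))
    , λ f f∈W → All.lookup (xs≤max w ws) (∈-filter⁺ (_∈? W) (∈-allFin f) f∈W)
    where
    open Extrema totalOrder
    ws = filter (_∈? W) (allFin n)

-- Domination and relative sections.

dominates? : (R : Representation d n) → ∀ x F → Dec (Dominates R x F)
dominates? R x F = any? λ i → dominatesIn? (Representation.isTotalOrder R i) x F

dominates-⊆ : (R : Representation d n) → F ⊆ G → Dominates R x G → Dominates R x F
dominates-⊆ R F⊆G (i , dom) = i , λ f f∈F → dom f (F⊆G f∈F)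

tailᴿ : Representation (suc d) n → Representation d n
tailᴿ R = record { order = order ∘ suc ; isTotalOrder = isTotalOrder ∘ suc }
  where open Representation R

-- In the induction, `X` collects the vertices whose links have been taken. Elements outside `W`
-- impose no condition: each left as the maximum of `W` in an order in which it dominated `X`.
relativeSection : Representation d n → (W X : Subset n) → SimplicialComplex n
relativeSection R W X = record
  { Face   = λ F → F ⊆ W × (∀ p → p ∈ W → Dominates R p (F ∪ X))
  ; closed = λ F⊆G (G⊆W , dom) →
      G⊆W ∘ F⊆G , λ p p∈W → dominates-⊆ R (∪-mono-⊆ F⊆G id) (dom p p∈W)
  }

module _ (R : Representation (suc d) n) (W X : Subset n) (y : Fin n) (y∈W : y ∈ W)
         (y-max : DominatesIn (Representation.order R zero) y W) where
  private
    _≼_ = Representation.order R zero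
    open IsTotalOrder (Representation.isTotalOrder R zero) using (antisym) renaming (trans to ≼-trans)
    Δ = relativeSection R W X

  dominates-tail : ∀ {p} → p ∈ W - y → y ∈ F → Dominates R p F → Dominates (tailᴿ R) p F
  dominates-tail {p = p} p∈W-y y∈F (zero , dom) =
    contradiction (subst (_∈ W - y) (antisym (y-max p (p-y⊆p W y p∈W-y)) (dom y y∈F)) p∈W-y) (x∉p-x W y)
  dominates-tail _ _ (suc i , dom) = i , dom

  module _ (y-undominating : ¬ DominatesIn _≼_ y X) where

    -- Domination of `X` in the first order would pass from `p` up to `y` by transitivity, against
    -- `y-undominating`.
    dominates-tail′ : ∀ {p} → p ∈ W → X ⊆ F → Dominates R p F → Dominates (tailᴿ R) p F
    dominates-tail′ {p = p} p∈W X⊆F (zero , dom) =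
      contradiction (λ f f∈X → ≼-trans (dom f (X⊆F f∈X)) (y-max p p∈W)) y-undominating
    dominates-tail′ _ _ (suc i , dom) = i , dom

    relativeSection-tail : Face (relativeSection (tailᴿ R) W X) ≐ Face Δ
    relativeSection-tail =
        (λ (F⊆W , dom) → F⊆W , λ p p∈W → let (i , dom-i) = dom p p∈W in suc i , dom-i)
      , (λ (F⊆W , dom) → F⊆W , λ p p∈W → dominates-tail′ p∈W (q⊆p∪q _ X) (dom p p∈W))

  module _ (y-dominating : DominatesIn _≼_ y X) where

    -- At `y` the first order suffices: maximality covers `F ⊆ W`, and `y-dominating` covers `X`.
    extend-to-y : F ⊆ W → (∀ p → p ∈ W - y → Dominates R p (F ∪ X)) → Face Δ F
    extend-to-y {F = F} F⊆W dom = F⊆W , dom′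
      where
      dom′ : ∀ p → p ∈ W → Dominates R p (F ∪ X)
      dom′ p p∈W with p ≟ y
      ... | yes refl = zero , λ f → [ y-max f ∘ F⊆W , y-dominating f ]′ ∘ x∈p∪q⁻ F X
      ... | no  p≢y  = dom p (x∈p∧x≢y⇒x∈p-y p∈W p≢y)

    relativeSection-deletion : IsDeletion Δ y (relativeSection R (W - y) X)
    relativeSection-deletion =
        (λ (F⊆W-y , dom) → extend-to-y (p-y⊆p W y ∘ F⊆W-y) dom , x∉p-x W y ∘ F⊆W-y)
      , (λ ((F⊆W , dom) , y∉F) → p⊆q-y F⊆W y∉F , λ p p∈W-y → dom p (p-y⊆p W y p∈W-y))

    -- Associativity of union moves `y` from the face into the chosen set. As `F ∪ ⁅ y ⁆` contains
    -- `y`, the points of `W - y` can use only the later orders.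
    relativeSection-link : IsLink Δ y (relativeSection (tailᴿ R) (W - y) (⁅ y ⁆ ∪ X))
    relativeSection-link =
        (λ {F} (F⊆W-y , dom) →
            extend-to-y (∪-least (p-y⊆p W y ∘ F⊆W-y) (⁅x⁆⊆p y∈W))
              (λ p p∈W-y → let (i , dom-i) = dom p p∈W-y in
                suc i , subst (DominatesIn (Representation.order R (suc i)) p) (sym (∪-assoc F ⁅ y ⁆ X)) dom-i)
          , x∉p-x W y ∘ F⊆W-y)
      , (λ {F} ((F∪y⊆W , dom) , y∉F) →
            p⊆q-y (F∪y⊆W ∘ p⊆p∪q ⁅ y ⁆) y∉F
          , λ p p∈W-y → subst (Dominates (tailᴿ R) p) (∪-assoc F ⁅ y ⁆ X)
              (dominates-tail p∈W-y (p⊆p∪q X (y∈p∪⁅y⁆ F y)) (dom p (p-y⊆p W y p∈W-y))))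

    -- A face containing `y` would make every `p ∈ W - y` dominate `⁅ y ⁆ ∪ X`, necessarily in a
    -- later order. Here the link is void and has no collapse, but the deletion is already the whole
    -- complex.
    relativeSection-nonvertex : ¬ (∀ p → p ∈ W - y → Dominates (tailᴿ R) p (⁅ y ⁆ ∪ X)) →
                                Face (relativeSection R (W - y) X) ≐ Face Δ
    relativeSection-nonvertex ¬vertex =
        proj₁ ∘ proj₁ relativeSection-deletion
      , λ F∈Δ → proj₂ relativeSection-deletion (F∈Δ , y∉F F∈Δ)
      where
      y∉F : Face Δ F → y ∉ F
      y∉F (_ , dom) y∈F = ¬vertex λ p p∈W-y →
        dominates-tail p∈W-y (p⊆p∪q X (x∈⁅x⁆ y))
          (dominates-⊆ R (∪-mono-⊆ (⁅x⁆⊆p y∈F) id) (dom p (p-y⊆p W y p∈W-y)))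

    relativeSection-point : ¬ Nonempty (W - y) → Face Δ ≐ Face (point y)
    relativeSection-point empty =
        (λ (F⊆W , _) → closed (point y) (W⊆y ∘ F⊆W) (inj₂ refl))
      , [ (λ { refl → extend-to-y ⊥⊆ vacuous }) , (λ { refl → extend-to-y (⁅x⁆⊆p y∈W) vacuous }) ]′
      where
      vacuous : ∀ p → p ∈ W - y → Dominates R p (F ∪ X)
      vacuous p p∈W-y = contradiction (p , p∈W-y) empty

      W⊆y : W ⊆ ⁅ y ⁆
      W⊆y = ∪-least (λ p∈W-y → contradiction (_ , p∈W-y) empty) id ∘ p⊆[p-y]∪⁅y⁆ W y

    -- The condition tested says that `⊥` lies in the link, so that `y` is a vertex; it is also what
    -- the induction hypothesis for the link requires.
    relativeSection-split :
      PairCollapsible (relativeSection R (W - y) X) →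
      ((∀ p → p ∈ W - y → Dominates (tailᴿ R) p (⁅ y ⁆ ∪ X)) →
       PairCollapsible (relativeSection (tailᴿ R) (W - y) (⁅ y ⁆ ∪ X))) →
      PairCollapsible Δ
    relativeSection-split deletion link
      with all? (λ p → (p ∈? (W - y)) →-dec dominates? (tailᴿ R) p (⁅ y ⁆ ∪ X))
    ... | no ¬vertex = pairCollapsible-resp-≐ (relativeSection-nonvertex ¬vertex) deletion
    ... | yes vertex =
      collapsible-link-deletion relativeSection-deletion relativeSection-link deletion (link vertex)

-- Induction on the number of orders and the size of `W`.

CollapsibleOver : Representation d n → (W X : Subset n) → Set₁
CollapsibleOver R W X = Nonempty W → (∀ p → p ∈ W → Dominates R p X) → PairCollapsible (relativeSection R W X)

-- Each appeal to a smaller case has to show that `X` is still dominated, that is, that `⊥` is a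
-- face: a void complex does not collapse to a point.
relativeSection-step : (R : Representation (suc d) n) (W X : Subset n) →
                       (∀ y → y ∈ W → CollapsibleOver R (W - y) X) →
                       (∀ W′ X′ → CollapsibleOver (tailᴿ R) W′ X′) → CollapsibleOver R W X
relativeSection-step R W X smaller tail W≠∅ dom
  with (y , y∈W , y-max) ← maximum (Representation.isTotalOrder R zero) W W≠∅
  with dominatesIn? (Representation.isTotalOrder R zero) y X
... | no y-undominating =
  pairCollapsible-resp-≐ (relativeSection-tail R W X y y∈W y-max y-undominating)
    (tail W X W≠∅ λ p p∈W → dominates-tail′ R W X y y∈W y-max y-undominating p∈W id (dom p p∈W))
... | yes y-dominating with nonempty? (W - y)
... | no W-y=∅ = isPoint y (relativeSection-point R W X y y∈W y-max y-dominating W-y=∅)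
... | yes W-y≠∅ =
  relativeSection-split R W X y y∈W y-max y-dominating
    (smaller y y∈W W-y≠∅ λ p p∈W-y → dom p (p-y⊆p W y p∈W-y))
    (tail (W - y) (⁅ y ⁆ ∪ X) W-y≠∅)

-- The descent is lexicographic: dropping an order decreases `d` and restarts accessibility for an
-- arbitrary `W′`; with the same orders, `W` loses an element.
relativeSection-collapsible : (R : Representation d n) (W X : Subset n) → Acc _<_ ∣ W ∣ → CollapsibleOver R W X
relativeSection-collapsible {d = zero} R W X _ (w , w∈W) dom = contradiction (proj₁ (dom w w∈W)) λ ()
relativeSection-collapsible {d = suc d} R W X (acc rec) =
  relativeSection-step R W X
    (λ y y∈W → relativeSection-collapsible R (W - y) X (rec (x∈p⇒∣p-x∣<∣p∣ y∈W)))
    (λ W′ X′ → relativeSection-collapsible (tailᴿ R) W′ X′ (<-wellFounded _))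

relativeSection-⊤-⊥ : (R : Representation d n) →
                      Face (relativeSection R ⊤ ⊥) ≐ Face (supremumSection R)
relativeSection-⊤-⊥ R =
    (λ (_ , dom) v → dominates-⊆ R (p⊆p∪q ⊥) (dom v ∈⊤))
  , (λ dom → ⊆⊤ , λ p _ → dominates-⊆ R (∪-least id ⊥⊆) (dom p))

theorem2 : (n d : ℕ) → 1 ≤ n → 1 ≤ d → (R : Representation d n) → Collapsible (supremumSection R)
theorem2 (suc n) (suc d) (s≤s _) (s≤s _) R =
  pairCollapsible⇒collapsible (pairCollapsible-resp-≐ (relativeSection-⊤-⊥ R)
    (relativeSection-collapsible R ⊤ ⊥ (<-wellFounded _) (zero , ∈⊤)
      λ p _ → zero , λ f f∈⊥ → contradiction f∈⊥ ∉⊥))
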